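{- Algorithm Enhanced-ED-Approx, on input $S,S',N_1,N_2$ and the list-decoders $\mathrm{Dec}_{\mathcal C_1},\mathrm{Dec}_{\mathcal C_2}$, runs in $$O\left(\frac{n}{N_1}\cdot T_{\mathrm{Dec}_{\mathcal C_1}}(N_1)+\frac{n}{N_2}\cdot T_{\mathrm{Dec}_{\mathcal C_2}}(N_2)+\frac{N_2L_1L_2}{\varepsilon^2}\cdot n\log\log n\right)$$ time for $n=\max(|S|,|S'|)$.
   Context: Setting. Let $\varepsilon>0$ be sufficiently small. For $t=1,2$, $\mathcal C_t$ is an insertion-deletion code of block length $N_t$ and rate $r_t$ over alphabet $\Sigma_{\mathcal C_t}$ that is $L_t$-list decodable from $N_t(1-\varepsilon)$ insertions and $N_t(1-\varepsilon)$ deletions, with decoding time $T_{\mathrm{Dec}_{\mathcal C_t}}(N_t)$: for a string $y$, the decoder output $\mathrm{Dec}_{\mathcal C_t}(y)$ is the set (of size at most $L_t$) of all indices $j$ such that the $j$-th codeword of $\mathcal C_t$ can be turned into $y$ by $N_t(1-\varepsilon)$ deletions and $N_t(1-\varepsilon)$ insertions. Let $I'$ be the concatenation of all codewords of $\mathcal C_2$, of length $|I'|=N_2|\Sigma_{\mathcal C_2}|^{N_2r_2}$; the block length of $\mathcal C_1$ is $N_1=|I'|$. Let $I_1$ be the concatenation of all codewords of $\mathcal C_1$, $I_2$ the string $I'$ repeated $|\mathcal C_1|$ times, and $I$ the string with $i$-th symbol $((I_1)_i,(I_2)_i)$. $S$ is the string with $i$-th symbol $(m_i,I_i)$ for an arbitrary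 content string $m$ with $|m|=|I|$; $S'$ is a given string over the same product alphabet. $S$ and $S'$ are split into consecutive blocks $S(i),S'(i)$ of length $N_1$, and each block is split into consecutive sub-blocks of length $N_2$: $S(k,k')$ denotes the $k'$-th sub-block of $S(k)$ and $S'(i,i')$ the $i'$-th sub-block of $S'(i)$. $C'_i$ is the $\mathcal C_1$-index component of $S'(i)$, and $C''_{i,i'}$ is the $\mathcal C_2$-index component of $S'(i,i')$. Algorithm Enhanced-ED-Approx. Let $w=1/\varepsilon$. Start with an empty bipartite graph $G$ with parts of size $|S|$ and $|S'|$, whose vertices are the positions of $S$ and of $S'$. For each block $S'(i)$: set $List_1\leftarrow\mathrm{Dec}_{\mathcal C_1}(C'_i)$; for each $j\in List_1$, for each $k\in[j-w,j+w]$, for each $i'\in[1,N_1/N_2]$: set $List_2\leftarrow\mathrm{Dec}_{\mathcal C_2}(C''_{i,i'})$; for each $j'\in List_2$ and each $k'\in[j'-w,j'+w]$, connect any pair of vertices of $G$ that correspond to identical symbols in $S(k,k')$ and $S'(i,i')$. Finally return a largest non-crossing matching of $G$ (a set of edges $(u_{i_1},v_{j_1}),\dots,(u_{i_t},v_{j_t})$ with $i_1<\dots<i_t$, $j_1<\dots<j_t$), computed by the Hunt–Szymanski algorithm, which finds a largest non-crossing matching of a bipartite graph with $n$ ordered vertices in each part and $r$ edges in $O((n+r)\log\log n)$ time.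
   Formalization: ε ranges over positive rationals instead of reals; and List₂ = Dec_{C₂}(C″_{i,i′}) is computed once for each pair (i,i′) and stored, not anew for each (j,k), since otherwise the (n/N₂)·T_{Dec_{C₂}}(N₂) term would fail. -}

module Defs where

open import Data.Bool.Base using (if_then_else_)
open import Data.Fin.Base using (Fin; toℕ)
import Data.Fin.Base as Fin
import Data.Fin.Properties as Fin
open import Data.Integer.Base using (+_; ∣_∣)
open import Data.List.Base using (List; []; _∷_; length; take; drop; upTo; allFin)
open import Data.List.Membership.Propositional using (_∈_)
open import Data.List.Relation.Unary.All using (All)
open import Data.List.Relation.Unary.All.Properties using (¬Any⇒All¬)
open import Data.List.Relation.Unary.AllPairs using (AllPairs; []; _∷_)
open import Data.List.Relation.Unary.Unique.Propositional using (Unique)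
open import Data.Nat.Base using (ℕ; zero; suc; _+_; _*_; _∸_; _⊔_; _≤_; NonZero; _/_)
open import Data.Nat.Logarithm using (⌊log₂_⌋)
open import Data.Nat.Properties using (m*n≢0)
open import Data.Product.Base using (_×_; _,_; proj₁; proj₂; ∃-syntax)
open import Data.Product.Properties using () renaming (≡-dec to ×-≡-dec)
open import Data.Rational.Base as ℚ using (ℚ; 1ℚ; Positive)
open import Data.Rational.Properties using (pos⇒nonZero)
open import Data.Unit.Base using (⊤; tt)
open import Data.Vec.Base using (Vec; []; _∷_; lookup; concat; tabulate; replicate; zip; toList)
open import Function.Bundles using (_⇔_)
open import Function.Definitions using (Injective)
open import Relation.Binary.Definitions using (DecidableEquality)
open import Relation.Binary.PropositionalEquality.Core using (_≡_)
open import Relation.Nullary.Decidable.Core using (Dec; yes; no; does)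

fromℕ : ℕ → ℚ
fromℕ n = + n ℚ./ 1

infixl 7 _÷_

_÷_ : (n d : ℕ) .{{_ : NonZero d}} → ℚ
n ÷ d = + n ℚ./ d

reciprocal : (ε : ℚ) .{{_ : Positive ε}} → ℚ
reciprocal ε = (ℚ.1/ ε) {{pos⇒nonZero ε}}

ceilDiv : (n d : ℕ) .{{_ : NonZero d}} → ℕ
ceilDiv n d = (n + (d ∸ 1)) / d

-- For n ≥ 4 this is ⌊log₂ (log₂ n)⌋ ≥ 1, which is Θ(log log n).
loglog : ℕ → ℕ
loglog n = ⌊log₂ ⌊log₂ n ⌋ ⌋

------------------------------------------------------------------------
-- Running time

-- Time is counted in elementary steps of a unit-cost RAM whose words hold
-- positions, codeword indices and symbols.  Programs pay for every step
-- explicitly: reading or comparing symbols, inserting an edge, entering a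
-- loop body, leaving a loop.  Only `return` and address computations
-- (such as the end points of a block) are free; each of those is O(1) and
-- attached to a step that is paid for.

record Timed (A : Set) : Set where
  constructor _after_
  field
    value : A
    cost  : ℕ

open Timed public

return : {A : Set} → A → Timed A
return x = x after 0

step : {A : Set} → A → Timed A
step x = x after 1

tick : ℕ → Timed ⊤
tick t = tt after t

infixl 1 _>>=_ _>>_

_>>=_ : {A B : Set} → Timed A → (A → Timed B) → Timed B
p >>= f = value (f (value p)) after (cost p + cost (f (value p)))

_>>_ : {A B : Set} → Timed A → Timed B → Timed B
p >> q = p >>= λ _ → q

for : {A S : Set} → List A → (A → S → Timed S) → S → Timed S
for []       body s = step s
for (x ∷ xs) body s = do
  tick 1
  s′ ← body x s
  for xs body s′

collect : {A B : Set} → List A → (A → Timed B) → Timed (List B)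
collect []       f = step []
collect (x ∷ xs) f = do
  tick 1
  y  ← f x
  ys ← collect xs f
  return (y ∷ ys)

table : {B : Set} (n : ℕ) → (Fin n → Timed B) → Timed (Vec B n)
table zero    f = step []
table (suc n) f = do
  tick 1
  y  ← f Fin.zero
  ys ← table n (λ i → f (Fin.suc i))
  return (y ∷ ys)

------------------------------------------------------------------------
-- Insertion-deletion codes

-- c ↝[ d , e ] y : d deletions and e insertions turn c into y.
data _↝[_,_]_ {A : Set} : List A → ℕ → ℕ → List A → Set where
  done   : [] ↝[ 0 , 0 ] []
  keep   : ∀ {a c y d e} → c ↝[ d , e ] y → (a ∷ c) ↝[ d , e ] (a ∷ y)
  delete : ∀ {a c y d e} → c ↝[ d , e ] y → (a ∷ c) ↝[ suc d , e ] y
  insert : ∀ {a c y d e} → c ↝[ d , e ] y → c ↝[ d , suc e ] (a ∷ y)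

-- A code over an alphabet of σ symbols with block length N and M codewords.
-- Its rate r is determined by σ ^ (N r) = M.
record Code (σ N M : ℕ) : Set where
  field
    codeword  : Fin M → Vec (Fin σ) N
    injective : Injective _≡_ _≡_ codeword

open Code public

module _ {σ N M : ℕ} (ε : ℚ) (C : Code σ N M) where

  Within : List (Fin σ) → Fin M → Set
  Within y j = ∃[ d ] ∃[ e ]
    toList (codeword C j) ↝[ d , e ] y
    × fromℕ d ℚ.≤ fromℕ N ℚ.* (1ℚ ℚ.- ε)
    × fromℕ e ℚ.≤ fromℕ N ℚ.* (1ℚ ℚ.- ε)

  ListDecodable : ℕ → Set
  ListDecodable L = ∀ y (js : List (Fin M)) →
    Unique js → All (Within y) js → length js ≤ L

  -- T N is the decoding time at block length N.  It is only assumed to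
  -- bound the decoder on strings no longer than a codeword.
  record Decoder (T : ℕ → ℕ) : Set where
    field
      decode  : List (Fin σ) → Timed (List (Fin M))
      unique  : ∀ y → Unique (value (decode y))
      correct : ∀ y j → j ∈ value (decode y) ⇔ Within y j
      time    : ∀ y → length y ≤ N → cost (decode y) ≤ T N

------------------------------------------------------------------------
-- Bipartite graphs and non-crossing matchings

record Graph (a b : ℕ) : Set where
  field
    edges  : List (Fin a × Fin b)
    simple : Unique edges

  size : ℕ
  size = length edges

open Graph public

emptyGraph : ∀ {a b} → Graph a b
emptyGraph = record { edges = [] ; simple = [] }

-- Connecting two vertices that are already adjacent has no effect.  It is
-- charged as one step: adjacency can be looked up in constant time in a
-- table whose memory need not be initialised.
connect : ∀ {a b} → Fin a → Fin b → Graph a b → Graph a b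
connect {a} {b} u v G = add ((u , v) ∈? edges G)
  where
  open import Data.List.Membership.DecPropositional
    (×-≡-dec (Fin._≟_ {n = a}) (λ {_} → Fin._≟_ {n = b})) using (_∈?_)

  add : Dec ((u , v) ∈ edges G) → Graph a b
  add (yes _) = G
  add (no ∉G) = record
    { edges = (u , v) ∷ edges G ; simple = ¬Any⇒All¬ (edges G) ∉G ∷ simple G }

record NonCrossingMatching {a b} (G : Graph a b) (es : List (Fin a × Fin b)) : Set where
  field
    inGraph    : All (_∈ edges G) es
    increasing : AllPairs (λ e f → proj₁ e Fin.< proj₁ f × proj₂ e Fin.< proj₂ f) es

-- The Hunt–Szymanski algorithm, known only through its specification and
-- its O((n + r) log log n) running time; n is the size of the larger part.
record HuntSzymanski : Set where
  field
    solve    : ∀ {a b} → Graph a b → Timed (List (Fin a × Fin b))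
    matching : ∀ {a b} (G : Graph a b) → NonCrossingMatching G (value (solve G))
    largest  : ∀ {a b} (G : Graph a b) es → NonCrossingMatching G es →
               length es ≤ length (value (solve G))
    c n₀     : ℕ
    time     : ∀ {a b} (G : Graph a b) → n₀ ≤ a ⊔ b →
               cost (solve G) ≤ c * ((a ⊔ b + size G) * loglog (a ⊔ b))

------------------------------------------------------------------------
-- The indexed string S

Symbol : (σ σ₁ σ₂ : ℕ) → Set
Symbol σ σ₁ σ₂ = Fin σ × (Fin σ₁ × Fin σ₂)

module _ {σ₁ σ₂ N₂ M₁ M₂ : ℕ}
         (C₁ : Code σ₁ (M₂ * N₂) M₁) (C₂ : Code σ₂ N₂ M₂) where

  I′ : Vec (Fin σ₂) (M₂ * N₂)
  I′ = concat (tabulate (codeword C₂))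

  I₁ : Vec (Fin σ₁) (M₁ * (M₂ * N₂))
  I₁ = concat (tabulate (codeword C₁))

  I₂ : Vec (Fin σ₂) (M₁ * (M₂ * N₂))
  I₂ = concat (replicate M₁ I′)

  indexed : ∀ {σ} → Vec (Fin σ) (M₁ * (M₂ * N₂)) → Vec (Symbol σ σ₁ σ₂) (M₁ * (M₂ * N₂))
  indexed m = zip m (zip I₁ I₂)

------------------------------------------------------------------------
-- The algorithm

-- The elements start, …, start + len − 1 of Fin n, as far as they exist.
slice : (n start len : ℕ) → List (Fin n)
slice n start len = take len (drop start (allFin n))

-- Those k with j − w ≤ k ≤ j + w.
window : ∀ {M} → ℕ → Fin M → List (Fin M)
window {M} w j = slice M (toℕ j ∸ w) (suc (toℕ j + w) ∸ (toℕ j ∸ w))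

-- Blocks, sub-blocks and codewords are numbered from 0.  A block of length
-- N₁ = M₂ * N₂ has N₁ / N₂ = M₂ sub-blocks; the last blocks and sub-blocks of
-- S′ may be shorter or empty.
module EnhancedED
  (HS : HuntSzymanski) (ε : ℚ) .{{_ : Positive ε}}
  {σ σ₁ σ₂ N₂ M₁ M₂ : ℕ} .{{_ : NonZero M₂}} .{{_ : NonZero N₂}}
  {C₁ : Code σ₁ (M₂ * N₂) M₁} {C₂ : Code σ₂ N₂ M₂} {T₁ T₂ : ℕ → ℕ}
  (Dec₁ : Decoder ε C₁ T₁) (Dec₂ : Decoder ε C₂ T₂)
  {ℓ ℓ′ : ℕ} (S : Vec (Symbol σ σ₁ σ₂) ℓ) (S′ : Vec (Symbol σ σ₁ σ₂) ℓ′)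
  where

  N₁ : ℕ
  N₁ = M₂ * N₂

  -- ⌊1/ε⌋, which gives the same integer interval [j − w , j + w] as 1/ε.
  w : ℕ
  w = ∣ ℚ.floor (reciprocal ε) ∣

  _≟_ : DecidableEquality (Symbol σ σ₁ σ₂)
  _≟_ = ×-≡-dec Fin._≟_ (×-≡-dec Fin._≟_ Fin._≟_)

  subBlock : Fin M₁ → Fin M₂ → List (Fin ℓ)
  subBlock k k′ = slice ℓ (toℕ k * N₁ + toℕ k′ * N₂) N₂

  blocks′ : ℕ
  blocks′ = ceilDiv ℓ′ N₁ {{m*n≢0 M₂ N₂}}

  block′ : ℕ → List (Fin ℓ′)
  block′ i = slice ℓ′ (i * N₁) N₁

  subBlock′ : ℕ → Fin M₂ → List (Fin ℓ′)
  subBlock′ i i′ = slice ℓ′ (i * N₁ + toℕ i′ * N₂) N₂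

  index₁ : ℕ → Timed (List (Fin σ₁))
  index₁ i = collect (block′ i) λ v → step (proj₁ (proj₂ (lookup S′ v)))

  index₂ : ℕ → Fin M₂ → Timed (List (Fin σ₂))
  index₂ i i′ = collect (subBlock′ i i′) λ v → step (proj₂ (proj₂ (lookup S′ v)))

  connectIdentical : List (Fin ℓ) → List (Fin ℓ′) → Graph ℓ ℓ′ → Timed (Graph ℓ ℓ′)
  connectIdentical us vs =
    for us λ u →
    for vs λ v G → do
      identical ← step (does (lookup S u ≟ lookup S′ v))
      if identical then step (connect u v G) else return G

  -- List₂ depends on i and i′ alone, so it is decoded once for each pair
  -- (i , i′) and looked up in the loops over j and k.  Decoding it afresh for
  -- every (j , k) would multiply the number of calls to Dec₂ by up to
  -- L₁ (2w + 1), and the (n / N₂) T₂ term would not account for them.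
  processBlock : ℕ → Graph ℓ ℓ′ → Timed (Graph ℓ ℓ′)
  processBlock i G₀ = do
    y     ← index₁ i
    List₁ ← Decoder.decode Dec₁ y
    Lists₂ ← table M₂ λ i′ → do
      y′ ← index₂ i i′
      Decoder.decode Dec₂ y′
    (for List₁         λ j  →
     for (window w j)  λ k  →
     for (allFin M₂)   λ i′ G → do
       List₂ ← step (lookup Lists₂ i′)
       (for List₂         λ j′ →
        for (window w j′) λ k′ →
        connectIdentical (subBlock k k′) (subBlock′ i i′)) G) G₀

  enhancedEDApprox : Timed (List (Fin ℓ × Fin ℓ′))
  enhancedEDApprox = do
    tick (ℓ + ℓ′)  -- allocating the vertices
    G ← for (upTo blocks′) processBlock emptyGraph
    HuntSzymanski.solve HS G

open EnhancedED public using (enhancedEDApprox)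

{-# OPTIONS --safe #-}
module Submission where

open import Data.Fin.Base using (Fin; toℕ)
import Data.Fin.Base as Fin
open import Data.Nat.Base using (ℕ; zero; suc; _+_; _*_; _∸_; _⊔_; _≤_; _<_; z≤n; s≤s; NonZero)
open import Data.Nat.Properties hiding (_≟_)
open import Data.Nat.DivMod using (m/n*n≤m; m≥n⇒m/n>0)
open import Data.Nat.Logarithm using (⌊log₂⌋-mono-≤)
open import Data.Nat.Tactic.RingSolver using (solve-∀)
open import Data.Integer.Base as ℤ using (+[1+_])
import Data.Integer.Properties as ℤ
open import Data.List.Base using (List; []; _∷_; length; allFin; drop; upTo)
open import Data.List.Properties using (length-take; length-tabulate; length-upTo)
open import Data.List.Relation.Unary.All as All using ([]; _∷_)
open import Data.List.Relation.Unary.AllPairs using ([]; _∷_)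
open import Data.Bool.Base using (true; false; if_then_else_)
open import Data.Product.Base using (_×_; _,_; ∃-syntax)
open import Data.Product.Properties using () renaming (≡-dec to ×-≡-dec)
import Data.Fin.Properties as Fin
open import Data.Rational.Base using (ℚ; 0ℚ; 1ℚ; Positive)
import Data.Rational.Properties as ℚ
open import Data.Rational.Unnormalised.Base as ℚᵘ using (mkℚᵘ)
import Data.Rational.Unnormalised.Properties as ℚᵘ
open import Data.Vec.Base using (Vec; toList; lookup)
open import Function.Base using (_∘_)
open import Function.Bundles using (Equivalence)
open import Relation.Nullary.Decidable.Core using (yes; no; does)
open import Relation.Binary.PropositionalEquality
import Data.Nat.Base as ℕ
import Data.Rational.Base as ℚ
open import Defs

-- Each of the ⌈|S′| / N₁⌉ ≤ 2 n / N₁ blocks decodes once with Dec₁ and M₂ = N₁ / N₂ times with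
-- Dec₂, which gives the first two terms.  The loops over j, k, i′, j′, k′ and the positions of the two
-- sub-blocks take O(L₁ · w · M₂ · L₂ · w · N₂ · N₂) = O(w² L₁ L₂ N₁ N₂) steps per block and add at
-- most that many edges; over all blocks this is O(N₂ L₁ L₂ w² n), where 1 ≤ w ≤ 1/ε.  Edges are counted
-- separately from time, since the decoding time must not acquire the factor log log n of the matching.

-- Loops

for-cost : ∀ {A S : Set} {body : A → S → Timed S} {c} → (∀ x s → cost (body x s) ≤ c) →
  ∀ xs s → cost (for xs body s) ≤ suc (length xs * suc c)
for-cost cost-body []       s = ≤-refl
for-cost {body = body} {c} cost-body (x ∷ xs) s = s≤s (begin
  cost (body x s) + cost (for xs body _) ≤⟨ +-mono-≤ (cost-body x s) (for-cost cost-body xs _) ⟩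
  c + suc (length xs * suc c)            ≡⟨ +-suc c _ ⟩
  suc c + length xs * suc c              ∎)
  where open ≤-Reasoning

for-growth : ∀ {A S : Set} (measure : S → ℕ) {body : A → S → Timed S} {t} →
  (∀ x s → measure (value (body x s)) ≤ measure s + t) →
  ∀ xs s → measure (value (for xs body s)) ≤ measure s + length xs * t
for-growth measure grows []       s = m≤m+n _ _
for-growth measure {body} {t} grows (x ∷ xs) s = begin
  measure (value (for xs body (value (body x s)))) ≤⟨ for-growth measure grows xs _ ⟩
  measure (value (body x s)) + length xs * t       ≤⟨ +-monoˡ-≤ _ (grows x s) ⟩
  measure s + t + length xs * t                    ≡⟨ +-assoc (measure s) t _ ⟩
  measure s + (t + length xs * t)                  ∎
  where open ≤-Reasoning

infixr 7 _⊛_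

_⊛_ : ∀ {a b} → 0 < a → 0 < b → 0 < a * b
_⊛_ = *-mono-≤

0<2 : 0 < 2
0<2 = s≤s z≤n

0<3 : 0 < 3
0<3 = s≤s z≤n

record Builds {a b} (t : ℕ) (f : Graph a b → Timed (Graph a b)) : Set where
  field
    cost-≤ : ∀ G → cost (f G) ≤ t
    size-≤ : ∀ G → size (value (f G)) ≤ size G + t

open Builds

for-builds : ∀ {a b A m t} {body : A → Graph a b → Timed (Graph a b)} (xs : List A) →
  0 < m → 0 < t → length xs ≤ m → (∀ x → Builds t (body x)) →
  Builds (3 * (m * t)) (for xs body)
for-builds {m = m} {t} {body} xs 0<m 0<t len builds = record
  { cost-≤ = λ G → begin
      cost (for xs body G)      ≤⟨ for-cost cost-body xs G ⟩
      suc (length xs * suc t)   ≤⟨ s≤s (*-monoˡ-≤ (suc t) len) ⟩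
      suc (m * suc t)           ≡⟨ cong suc (*-suc m t) ⟩
      1 + (m + m * t)           ≤⟨ +-mono-≤ (*-mono-≤ 0<m 0<t) (+-monoˡ-≤ (m * t) m≤mt) ⟩
      m * t + (m * t + m * t)   ≡⟨ cong (λ z → m * t + (m * t + z)) (sym (+-identityʳ _)) ⟩
      3 * (m * t)               ∎
  ; size-≤ = λ G → begin
      size (value (for xs body G)) ≤⟨ for-growth size size-body xs G ⟩
      size G + length xs * t       ≤⟨ +-monoʳ-≤ (size G) (*-monoˡ-≤ t len) ⟩
      size G + m * t               ≤⟨ +-monoʳ-≤ (size G) (m≤m+n (m * t) _) ⟩
      size G + 3 * (m * t)         ∎ }
  where
  open ≤-Reasoning
  cost-body = λ x → cost-≤ (builds x)
  size-body = λ x → size-≤ (builds x)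
  m≤mt : m ≤ m * t
  m≤mt = subst (_≤ m * t) (*-identityʳ m) (*-monoʳ-≤ m 0<t)

collect-cost : ∀ {A B : Set} (f : A → Timed B) → (∀ x → cost (f x) ≤ 1) → ∀ xs →
  cost (collect xs f) ≤ suc (length xs * 2)
collect-cost f f≤1 []       = ≤-refl
collect-cost f f≤1 (x ∷ xs) = s≤s (begin
  cost (f x) + (cost (collect xs f) + 0) ≡⟨ cong (cost (f x) +_) (+-identityʳ _) ⟩
  cost (f x) + cost (collect xs f)       ≤⟨ +-mono-≤ (f≤1 x) (collect-cost f f≤1 xs) ⟩
  2 + length xs * 2                      ∎)
  where open ≤-Reasoning

length-collect : ∀ {A B : Set} (f : A → Timed B) xs → length (value (collect xs f)) ≡ length xs
length-collect f []       = refl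
length-collect f (x ∷ xs) = cong suc (length-collect f xs)

table-cost : ∀ {B : Set} n (f : Fin n → Timed B) {c} → (∀ i → cost (f i) ≤ c) →
  cost (table n f) ≤ suc (n * suc c)
table-cost zero    f f≤c = ≤-refl
table-cost (suc n) f {c} f≤c = s≤s (begin
  cost (f Fin.zero) + (cost (table n f′) + 0) ≡⟨ cong (cost (f Fin.zero) +_) (+-identityʳ _) ⟩
  cost (f Fin.zero) + cost (table n f′)       ≤⟨ +-mono-≤ (f≤c _) (table-cost n f′ (f≤c ∘ Fin.suc)) ⟩
  c + suc (n * suc c)                         ≡⟨ +-suc c _ ⟩
  suc c + n * suc c                           ∎)
  where
  open ≤-Reasoning
  f′ = f ∘ Fin.suc

lookup-table : ∀ {B : Set} n (f : Fin n → Timed B) i →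
  lookup (value (table n f)) i ≡ value (f i)
lookup-table (suc n) f Fin.zero    = refl
lookup-table (suc n) f (Fin.suc i) = lookup-table n (f ∘ Fin.suc) i

length-slice : ∀ n start len → length (slice n start len) ≤ len
length-slice n start len =
  ≤-trans (≤-reflexive (length-take len (drop start (allFin n)))) (m⊓n≤m len _)

length-window : ∀ {M w} → 0 < w → (j : Fin M) → length (window w j) ≤ 3 * w
length-window {M} {w} 0<w j = ≤-trans (length-slice M (toℕ j ∸ w) _)
  (m≤n+o⇒m∸n≤o (suc (toℕ j + w)) (toℕ j ∸ w) (begin
    suc (toℕ j + w)                  ≤⟨ +-mono-≤ 0<w (+-monoˡ-≤ w (m≤n+m∸n (toℕ j) w)) ⟩
    w + (w + (toℕ j ∸ w) + w)        ≡⟨ rearrange w (toℕ j ∸ w) ⟩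
    (toℕ j ∸ w) + 3 * w              ∎))
  where
  open ≤-Reasoning
  rearrange : ∀ a b → a + (a + b + a) ≡ b + 3 * a
  rearrange = solve-∀

size-connect : ∀ {a b} (u : Fin a) (v : Fin b) G → size (connect u v G) ≤ suc (size G)
size-connect {a} {b} u v G with (u , v) ∈? edges G
  where open import Data.List.Membership.DecPropositional (×-≡-dec (Fin._≟_ {n = a}) (λ {_} → Fin._≟_ {n = b})) using (_∈?_)
... | yes _ = n≤1+n _
... | no  _ = ≤-refl

-- Codes

keepAll : ∀ {A : Set} (xs : List A) → xs ↝[ 0 , 0 ] xs
keepAll []       = done
keepAll (x ∷ xs) = keep (keepAll xs)

listSize-positive : ∀ {σ N M L} .{{_ : NonZero M}} {ε} (C : Code σ N M) →
  ε ℚ.< 1ℚ → ListDecodable ε C L → 0 < L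
listSize-positive {N = N} {M = suc _} {ε = ε} C ε<1 listDecodable =
  listDecodable (toList (codeword C Fin.zero)) (Fin.zero ∷ []) ([] ∷ [])
    ((0 , 0 , keepAll _ , 0≤radius , 0≤radius) ∷ [])
  where
  0≤1-ε : 0ℚ ℚ.≤ 1ℚ ℚ.- ε
  0≤1-ε = subst (ℚ._≤ 1ℚ ℚ.- ε) (ℚ.+-inverseʳ ε) (ℚ.+-monoˡ-≤ (ℚ.- ε) (ℚ.<⇒≤ ε<1))

  0≤radius : 0ℚ ℚ.≤ fromℕ N ℚ.* (1ℚ ℚ.- ε)
  0≤radius = ℚ.nonNegative⁻¹ _
    {{ℚ.nonNeg*nonNeg⇒nonNeg (fromℕ N) {{ℚ.normalize-nonNeg N 1}} (1ℚ ℚ.- ε)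
      {{ℚ.nonNegative 0≤1-ε}}}}

length-decode : ∀ {σ N M L T} {ε} {C : Code σ N M} (Dec : Decoder ε C T) →
  ListDecodable ε C L → ∀ y → length (value (Decoder.decode Dec y)) ≤ L
length-decode Dec listDecodable y = listDecodable y _ (unique y)
  (All.tabulate λ {j} → Equivalence.to (correct y j))
  where open Decoder Dec

-- Fractions

÷-mono : ∀ a b c d .{{_ : NonZero b}} .{{_ : NonZero d}} → a * d ≤ c * b → (a ÷ b) ℚ.≤ (c ÷ d)
÷-mono a b@(suc _) c d@(suc _) ad≤cb = ℚ.toℚᵘ-cancel-≤ (begin
  ℚ.toℚᵘ (a ÷ b)   ≃⟨ ℚ.toℚᵘ-fromℚᵘ (mkℚᵘ (ℤ.+ a) _) ⟩
  mkℚᵘ (ℤ.+ a) _     ≤⟨ ℚᵘ.*≤* (subst₂ ℤ._≤_ (ℤ.pos-* a d) (ℤ.pos-* c b) (ℤ.+≤+ ad≤cb)) ⟩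
  mkℚᵘ (ℤ.+ c) _     ≃⟨ ℚ.toℚᵘ-fromℚᵘ (mkℚᵘ (ℤ.+ c) _) ⟨
  ℚ.toℚᵘ (c ÷ d)   ∎)
  where open ℚᵘ.≤-Reasoning

fromℕ-mono : ∀ {a b} → a ≤ b → fromℕ a ℚ.≤ fromℕ b
fromℕ-mono {a} {b} a≤b = ÷-mono a 1 b 1 (*-monoˡ-≤ 1 a≤b)

÷-* : ∀ a b c d .{{_ : NonZero b}} .{{_ : NonZero d}} →
  (a ÷ b) ℚ.* (c ÷ d) ≡ ((a * c) ÷ (b * d)) {{m*n≢0 b d}}
÷-* a b@(suc _) c d@(suc _) = ℚ.toℚᵘ-injective (begin-equality
  ℚ.toℚᵘ ((a ÷ b) ℚ.* (c ÷ d))               ≃⟨ ℚ.toℚᵘ-homo-* (a ÷ b) (c ÷ d) ⟩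
  ℚ.toℚᵘ (a ÷ b) ℚᵘ.* ℚ.toℚᵘ (c ÷ d)         ≃⟨ ℚᵘ.*-cong (ℚ.toℚᵘ-fromℚᵘ (mkℚᵘ (ℤ.+ a) _)) (ℚ.toℚᵘ-fromℚᵘ (mkℚᵘ (ℤ.+ c) _)) ⟩
  mkℚᵘ (ℤ.+ a ℤ.* ℤ.+ c) _                       ≡⟨ cong (λ z → mkℚᵘ z _) (ℤ.pos-* a c) ⟨
  mkℚᵘ (ℤ.+ (a * c)) _                         ≃⟨ ℚ.toℚᵘ-fromℚᵘ (mkℚᵘ (ℤ.+ (a * c)) _) ⟨
  ℚ.toℚᵘ ((a * c) ÷ (b * d))                 ∎)
  where open ℚᵘ.≤-Reasoning

fromℕ-+ : ∀ a b → fromℕ (a + b) ≡ fromℕ a ℚ.+ fromℕ b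
fromℕ-+ a b = ℚ.toℚᵘ-injective (begin-equality
  ℚ.toℚᵘ (fromℕ (a + b))                        ≃⟨ ℚ.toℚᵘ-fromℚᵘ (mkℚᵘ (ℤ.+ (a + b)) 0) ⟩
  mkℚᵘ (ℤ.+ (a + b)) 0                            ≡⟨ cong (λ z → mkℚᵘ z 0) (cong₂ ℤ._+_ (sym (ℤ.*-identityʳ (ℤ.+ a))) (sym (ℤ.*-identityʳ (ℤ.+ b)))) ⟩
  mkℚᵘ (ℤ.+ a) 0 ℚᵘ.+ mkℚᵘ (ℤ.+ b) 0                ≃⟨ ℚᵘ.+-cong (ℚ.toℚᵘ-fromℚᵘ (mkℚᵘ (ℤ.+ a) 0)) (ℚ.toℚᵘ-fromℚᵘ (mkℚᵘ (ℤ.+ b) 0)) ⟨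
  ℚ.toℚᵘ (fromℕ a) ℚᵘ.+ ℚ.toℚᵘ (fromℕ b)        ≃⟨ ℚ.toℚᵘ-homo-+ (fromℕ a) (fromℕ b) ⟨
  ℚ.toℚᵘ (fromℕ a ℚ.+ fromℕ b)                  ∎)
  where open ℚᵘ.≤-Reasoning

fromℕ-≤-*÷ : ∀ a K b d .{{_ : NonZero d}} → a * d ≤ K * b → fromℕ a ℚ.≤ fromℕ K ℚ.* (b ÷ d)
fromℕ-≤-*÷ a K b d ad≤Kb = begin
  fromℕ a                                  ≤⟨ ÷-mono a 1 (K * b) (1 * d) {{_}} {{m*n≢0 1 d}} 
     (subst₂ _≤_ (cong (a *_) (sym (*-identityˡ d))) (sym (*-identityʳ (K * b))) ad≤Kb) ⟩
  ((K * b) ÷ (1 * d)) {{m*n≢0 1 d}}        ≡⟨ ÷-* K 1 b d ⟨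
  fromℕ K ℚ.* (b ÷ d)                      ∎
  where open ℚ.≤-Reasoning

reciprocal-bounds : ∀ ε .{{_ : Positive ε}} → ε ℚ.< 1ℚ →
  let w = ℤ.∣ ℚ.floor (reciprocal ε) ∣ in
  ∃[ p ] ∃[ q ] reciprocal ε ≡ p ÷ suc q × 0 < w × w * suc q ≤ p
reciprocal-bounds (ℚ.mkℚ +[1+ a ] b _) (ℚ.*<* (ℤ.+<+ a<b)) =
  suc b , a , sym (ℚ.fromℚᵘ-toℚᵘ (ℚ.mkℚ +[1+ b ] a _)) ,
  subst (0 <_) (sym floor≡) (m≥n⇒m/n>0 {suc b} {suc a} (subst₂ _≤_ (*-identityʳ (suc a)) (+-identityʳ (suc b)) (<⇒≤ a<b))) ,
  subst (λ w → w * suc a ≤ suc b) (sym floor≡) (m/n*n≤m (suc b) (suc a))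
  where
  floor≡ : ℤ.∣ ℤ.+ 1 ℤ.* (ℤ.+ (suc b ℕ./ suc a)) ∣ ≡ suc b ℕ./ suc a
  floor≡ = cong ℤ.∣_∣ (ℤ.*-identityˡ (ℤ.+ (suc b ℕ./ suc a)))

-- Running time of the algorithm

-- A factor 3 for each of the seven nested loops and for each of the two windows (2 w + 1 ≤ 3 w), a
-- factor 2 for comparing and connecting, and a factor 2 for the table lookup.
abstract
  κ : ℕ
  κ = 3 ℕ.^ 9 * 4

  loop-constant : ∀ L₁ L₂ w M N →
    3 * (L₁ * (3 * (3 * w * (3 * (M * (2 * (3 * (L₂ * (3 * (3 * w * (3 * (N * (3 * (N * 2)))))))))))))) ≡
    κ * (N * L₁ * L₂ * (w * w) * (M * N))
  loop-constant = rearrange 3 2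
    where
    rearrange : ∀ a b L₁ L₂ w M N →
      a * (L₁ * (a * (a * w * (a * (M * (b * (a * (L₂ * (a * (a * w * (a * (N * (a * (N * b)))))))))))))) ≡
      a * a * a * a * a * a * a * a * a * b * b * (N * L₁ * L₂ * (w * w) * (M * N))
    rearrange = solve-∀

module _
  (HS : HuntSzymanski) (ε : ℚ) .{{_ : Positive ε}}
  {σ σ₁ σ₂ N₂ M₁ M₂ : ℕ} .{{_ : NonZero M₂}} .{{_ : NonZero N₂}}
  {C₁ : Code σ₁ (M₂ * N₂) M₁} {C₂ : Code σ₂ N₂ M₂} {T₁ T₂ : ℕ → ℕ}
  (Dec₁ : Decoder ε C₁ T₁) (Dec₂ : Decoder ε C₂ T₂)
  {ℓ ℓ′ : ℕ} (S : Vec (Symbol σ σ₁ σ₂) ℓ) (S′ : Vec (Symbol σ σ₁ σ₂) ℓ′)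
  where

  open EnhancedED HS ε Dec₁ Dec₂ S S′ hiding (enhancedEDApprox)

  connectIdentical-builds : ∀ us vs → length us ≤ N₂ → length vs ≤ N₂ →
    Builds (3 * (N₂ * (3 * (N₂ * 2)))) (connectIdentical us vs)
  connectIdentical-builds us vs us≤ vs≤ =
    for-builds us 0<N₂ 0<inner us≤ λ u →
    for-builds vs 0<N₂ 0<2 vs≤ λ v → record
      { cost-≤ = λ G → s≤s (branch-cost (does (lookup S u ≟ lookup S′ v)) u v G)
      ; size-≤ = λ G → branch-size (does (lookup S u ≟ lookup S′ v)) u v G }
    where
    0<N₂ : 0 < N₂
    0<N₂ = ℕ.>-nonZero⁻¹ N₂
    0<inner = 0<3 ⊛ 0<N₂ ⊛ 0<2

    branch-cost : ∀ b u v G → cost (if b then step (connect u v G) else return G) ≤ 1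
    branch-cost true  u v G = ≤-refl
    branch-cost false u v G = z≤n

    branch-size : ∀ b u v G →
      size (value (if b then step (connect u v G) else return G)) ≤ size G + 2
    branch-size true  u v G = ≤-trans (size-connect u v G)
      (≤-trans (≤-reflexive (+-comm 1 (size G))) (+-monoʳ-≤ (size G) (s≤s z≤n)))
    branch-size false u v G = m≤m+n (size G) 2

  index₁-cost : ∀ i → cost (index₁ i) ≤ suc (N₁ * 2)
  index₁-cost i = ≤-trans (collect-cost _ (λ _ → ≤-refl) (block′ i))
    (s≤s (*-monoˡ-≤ 2 (length-slice ℓ′ (i * N₁) N₁)))

  index₂-cost : ∀ i i′ → cost (index₂ i i′) ≤ suc (N₂ * 2)
  index₂-cost i i′ = ≤-trans (collect-cost _ (λ _ → ≤-refl) (subBlock′ i i′))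
    (s≤s (*-monoˡ-≤ 2 (length-slice ℓ′ (i * N₁ + toℕ i′ * N₂) N₂)))

  decode₁-cost : ∀ i → cost (Decoder.decode Dec₁ (value (index₁ i))) ≤ T₁ N₁
  decode₁-cost i = Decoder.time Dec₁ _
    (≤-trans (≤-reflexive (length-collect _ (block′ i))) (length-slice ℓ′ (i * N₁) N₁))

  decode₂-cost : ∀ i i′ → cost (Decoder.decode Dec₂ (value (index₂ i i′))) ≤ T₂ N₂
  decode₂-cost i i′ = Decoder.time Dec₂ _
    (≤-trans (≤-reflexive (length-collect _ (subBlock′ i i′))) (length-slice ℓ′ (i * N₁ + toℕ i′ * N₂) N₂))

  module _ {L₁ L₂ : ℕ} (0<L₁ : 0 < L₁) (0<L₂ : 0 < L₂) (0<w : 0 < w)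
    (listDecodable₁ : ListDecodable ε C₁ L₁) (listDecodable₂ : ListDecodable ε C₂ L₂) where

    loops prelude : ℕ
    loops = κ * (N₂ * L₁ * L₂ * (w * w) * N₁)
    prelude = suc (N₁ * 2) + (T₁ N₁ + suc (M₂ * suc (suc (N₂ * 2) + T₂ N₂)))

    matchBlocks : ℕ → List (Fin M₁) → Vec (List (Fin M₂)) M₂ → Graph ℓ ℓ′ → Timed (Graph ℓ ℓ′)
    matchBlocks i List₁ Lists₂ =
      for List₁         λ j  →
      for (window w j)  λ k  →
      for (allFin M₂)   λ i′ G → do
        List₂ ← step (lookup Lists₂ i′)
        (for List₂         λ j′ →
         for (window w j′) λ k′ →
         connectIdentical (subBlock k k′) (subBlock′ i i′)) G

    matchBlocks-builds : ∀ i List₁ Lists₂ → length List₁ ≤ L₁ →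
      (∀ i′ → length (lookup Lists₂ i′) ≤ L₂) → Builds loops (matchBlocks i List₁ Lists₂)
    matchBlocks-builds i List₁ Lists₂ List₁≤ Lists₂≤ = subst (λ t → Builds t (matchBlocks i List₁ Lists₂))
      (loop-constant L₁ L₂ w M₂ N₂)
      (for-builds List₁ 0<L₁ 0<k List₁≤ λ j →
       for-builds (window w j) 0<W 0<i′ (length-window 0<w j) λ k →
       for-builds (allFin M₂) 0<M₂ 0<body (≤-reflexive (length-tabulate _)) λ i′ →
       afterStep (lookup Lists₂ i′) 0<j′ (for-builds (lookup Lists₂ i′) 0<L₂ 0<k′ (Lists₂≤ i′) λ j′ →
       for-builds (window w j′) 0<W 0<connect (length-window 0<w j′) λ k′ →
       connectIdentical-builds (subBlock k k′) (subBlock′ i i′)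
         (length-slice ℓ (toℕ k * N₁ + toℕ k′ * N₂) N₂)
         (length-slice ℓ′ (i * N₁ + toℕ i′ * N₂) N₂)))
      where
      0<M₂ = ℕ.>-nonZero⁻¹ M₂
      0<N₂ = ℕ.>-nonZero⁻¹ N₂
      0<W = 0<3 ⊛ 0<w
      0<connect = 0<3 ⊛ 0<N₂ ⊛ 0<3 ⊛ 0<N₂ ⊛ 0<2
      0<k′ = 0<3 ⊛ 0<W ⊛ 0<connect
      0<j′ = 0<3 ⊛ 0<L₂ ⊛ 0<k′
      0<body = 0<2 ⊛ 0<j′
      0<i′ = 0<3 ⊛ 0<M₂ ⊛ 0<body
      0<k = 0<3 ⊛ 0<W ⊛ 0<i′

      afterStep : ∀ {t} {f : Graph ℓ ℓ′ → Timed (Graph ℓ ℓ′)} {A : Set} (x : A) →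
        0 < t → Builds t f → Builds (2 * t) (λ G → step x >>= λ _ → f G)
      afterStep {t} x 0<t f-builds = record
        { cost-≤ = λ G → ≤-trans (+-mono-≤ 0<t (cost-≤ f-builds G)) (≤-reflexive (cong (t +_) (sym (+-identityʳ t))))
        ; size-≤ = λ G → ≤-trans (size-≤ f-builds G) (+-monoʳ-≤ (size G) (m≤m+n t _)) }

    module _ (i : ℕ) where

      List₁′ : List (Fin M₁)
      List₁′ = value (Decoder.decode Dec₁ (value (index₁ i)))

      decodeSub : Fin M₂ → Timed (List (Fin M₂))
      decodeSub i′ = index₂ i i′ >>= Decoder.decode Dec₂

      matching-builds : Builds loops (matchBlocks i List₁′ (value (table M₂ decodeSub)))
      matching-builds = matchBlocks-builds i List₁′ (value (table M₂ decodeSub))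
        (length-decode Dec₁ listDecodable₁ _)
        λ i′ → subst (λ js → length js ≤ L₂) (sym (lookup-table M₂ decodeSub i′))
          (length-decode Dec₂ listDecodable₂ _)

      processBlock-cost : ∀ G → cost (processBlock i G) ≤ prelude + loops
      processBlock-cost G = begin
        cost (index₁ i) + (cost (Decoder.decode Dec₁ (value (index₁ i))) + (cost (table M₂ decodeSub) + _))
          ≤⟨ +-mono-≤ (index₁-cost i) (+-mono-≤ (decode₁-cost i) (+-mono-≤
               (table-cost M₂ decodeSub λ i′ → +-mono-≤ (index₂-cost i i′) (decode₂-cost i i′))
               (cost-≤ matching-builds G))) ⟩
        suc (N₁ * 2) + (T₁ N₁ + (suc (M₂ * suc (suc (N₂ * 2) + T₂ N₂)) + loops))
          ≡⟨ cong (suc (N₁ * 2) +_) (sym (+-assoc (T₁ N₁) _ loops)) ⟩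
        suc (N₁ * 2) + (T₁ N₁ + suc (M₂ * suc (suc (N₂ * 2) + T₂ N₂)) + loops)
          ≡⟨ sym (+-assoc (suc (N₁ * 2)) _ loops) ⟩
        prelude + loops ∎
        where open ≤-Reasoning

      processBlock-size : ∀ G → size (value (processBlock i G)) ≤ size G + loops
      processBlock-size = size-≤ matching-builds

    enhancedED-cost : HuntSzymanski.n₀ HS ≤ ℓ ⊔ ℓ′ →
      cost (enhancedEDApprox HS ε Dec₁ Dec₂ S S′) ≤
        (ℓ + ℓ′) + (suc (blocks′ * suc (prelude + loops)) +
          HuntSzymanski.c HS * ((ℓ ⊔ ℓ′ + blocks′ * loops) * loglog (ℓ ⊔ ℓ′)))
    enhancedED-cost n₀≤n = +-monoʳ-≤ (ℓ + ℓ′) (+-mono-≤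
      (subst (λ b → cost building ≤ suc (b * suc (prelude + loops))) (length-upTo blocks′)
        (for-cost processBlock-cost (upTo blocks′) emptyGraph))
      (≤-trans (HuntSzymanski.time HS _ n₀≤n) (*-monoʳ-≤ c (*-monoˡ-≤ (loglog (ℓ ⊔ ℓ′))
        (+-monoʳ-≤ (ℓ ⊔ ℓ′) (subst (λ b → size (value building) ≤ b * loops) (length-upTo blocks′)
          (for-growth size processBlock-size (upTo blocks′) emptyGraph)))))))
      where
      open HuntSzymanski HS using (c)
      building = for (upTo blocks′) processBlock emptyGraph

ceilDiv-*-≤ : ∀ n d .{{_ : NonZero d}} → ceilDiv n d * d ≤ n + d
ceilDiv-*-≤ n d = ≤-trans (m/n*n≤m (n + (d ∸ 1)) d) (+-monoʳ-≤ n (m∸n≤m d 1))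

-- The constant collects the vertices (2), the exit of the loop over blocks (1), reading the
-- indices and building the tables (18), connecting (2 κ) and the matching (c (1 + 2 κ)).
constant : ℕ → ℕ → ℕ
constant k c = 21 + 2 * k + c * (1 + 2 * k)

total-cost-≤ : ∀ {ℓ ℓ′ n B X M N g} k c t₁ t₂ → ℓ ≤ n → ℓ′ ≤ n → B * (M * N) ≤ n + n →
  0 < M → 0 < N → 0 < X → 0 < n → 0 < g →
  (ℓ + ℓ′) + (suc (B * suc (suc (M * N * 2) + (t₁ + suc (M * suc (suc (N * 2) + t₂))) + k * (X * (M * N)))) +
    c * ((n + B * (k * (X * (M * N)))) * g))
  ≤ B * t₁ + B * M * t₂ + constant k c * (X * (n * g))
total-cost-≤ {ℓ} {ℓ′} {n} {B} {X} {M} {N} {g} k c t₁ t₂ ℓ≤n ℓ′≤n BMN≤2n 0<M 0<N 0<X 0<n 0<g = begin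
  (ℓ + ℓ′) + (suc (B * suc (suc (M * N * 2) + (t₁ + suc (M * suc (suc (N * 2) + t₂))) + k * (X * (M * N)))) +
    c * ((n + B * (k * (X * (M * N)))) * g))
    ≡⟨ cong (λ z → (ℓ + ℓ′) + (suc z + c * ((n + B * (k * (X * (M * N)))) * g))) (expand B M N t₁ t₂ (k * (X * (M * N)))) ⟩
  (ℓ + ℓ′) + (suc (B * (3 + 2 * M + 4 * (M * N)) + (B * t₁ + B * M * t₂) + B * (k * (X * (M * N)))) +
    c * ((n + B * (k * (X * (M * N)))) * g))
    ≤⟨ +-mono-≤ (+-mono-≤ (≤-trans ℓ≤n n≤Y) (≤-trans ℓ′≤n n≤Y))
         (+-mono-≤ (+-mono-≤ (≤-trans 0<n n≤Y) (+-mono-≤ (+-monoˡ-≤ (B * t₁ + B * M * t₂) reading≤) connecting≤))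
                   (*-monoʳ-≤ c matching≤)) ⟩
  (Y + Y) + (Y + (9 * (Y + Y) + (B * t₁ + B * M * t₂) + k * (Y + Y)) + c * (Y + k * (Y + Y)))
    ≡⟨ gather k c Y (B * t₁ + B * M * t₂) ⟩
  B * t₁ + B * M * t₂ + constant k c * Y ∎
  where
  open ≤-Reasoning
  Y = X * (n * g)

  ≤-*ʳ : ∀ {a b} → 0 < b → a ≤ a * b
  ≤-*ʳ {a} {b} 0<b = m≤m*n a b {{ℕ.>-nonZero 0<b}}

  ≤-*ˡ : ∀ {a b} → 0 < b → a ≤ b * a
  ≤-*ˡ {a} {b} 0<b = m≤n*m a b {{ℕ.>-nonZero 0<b}}

  n≤Y : n ≤ Y
  n≤Y = ≤-trans (≤-*ʳ 0<g) (≤-*ˡ 0<X)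

  Xn≤Y : X * n ≤ Y
  Xn≤Y = *-monoʳ-≤ X (≤-*ʳ 0<g)

  expand : ∀ B M N t₁ t₂ s →
    B * suc (suc (M * N * 2) + (t₁ + suc (M * suc (suc (N * 2) + t₂))) + s) ≡
    B * (3 + 2 * M + 4 * (M * N)) + (B * t₁ + B * M * t₂) + B * s
  expand = solve-∀

  gather : ∀ k c Y z →
    (Y + Y) + (Y + (9 * (Y + Y) + z + k * (Y + Y)) + c * (Y + k * (Y + Y))) ≡
    z + (21 + 2 * k + c * (1 + 2 * k)) * Y
  gather = solve-∀

  reading≤ : B * (3 + 2 * M + 4 * (M * N)) ≤ 9 * (Y + Y)
  reading≤ = begin
    B * (3 + 2 * M + 4 * (M * N))
      ≤⟨ *-monoʳ-≤ B (+-monoˡ-≤ (4 * (M * N)) (+-mono-≤ (*-monoʳ-≤ 3 (0<M ⊛ 0<N)) (*-monoʳ-≤ 2 (≤-*ʳ {M} {N} 0<N)))) ⟩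
    B * (3 * (M * N) + 2 * (M * N) + 4 * (M * N)) ≡⟨ sum B (M * N) ⟩
    9 * (B * (M * N))                             ≤⟨ *-monoʳ-≤ 9 (≤-trans BMN≤2n (+-mono-≤ n≤Y n≤Y)) ⟩
    9 * (Y + Y)                                   ∎
    where
    sum : ∀ B q → B * (3 * q + 2 * q + 4 * q) ≡ 9 * (B * q)
    sum = solve-∀

  pull : ∀ B k X q → B * (k * (X * q)) ≡ k * (X * (B * q))
  pull = solve-∀

  loops≤ : B * (k * (X * (M * N))) ≤ k * (X * (n + n))
  loops≤ = ≤-trans (≤-reflexive (pull B k X (M * N))) (*-monoʳ-≤ k (*-monoʳ-≤ X BMN≤2n))

  connecting≤ : B * (k * (X * (M * N))) ≤ k * (Y + Y)
  connecting≤ = ≤-trans loops≤ (*-monoʳ-≤ k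
    (≤-trans (≤-reflexive (*-distribˡ-+ X n n)) (+-mono-≤ Xn≤Y Xn≤Y)))

  matching≤ : (n + B * (k * (X * (M * N)))) * g ≤ Y + k * (Y + Y)
  matching≤ = begin
    (n + B * (k * (X * (M * N)))) * g   ≤⟨ *-monoˡ-≤ g (+-mono-≤ (≤-*ˡ 0<X) loops≤) ⟩
    (X * n + k * (X * (n + n))) * g     ≡⟨ distribute X n k g ⟩
    Y + k * (Y + Y)                     ∎
    where
    distribute : ∀ X n k g → (X * n + k * (X * (n + n))) * g ≡ X * (n * g) + k * (X * (n * g) + X * (n * g))
    distribute = solve-∀

loglog-positive : ∀ {n} → 4 ≤ n → 0 < loglog n
loglog-positive 4≤n = ⌊log₂⌋-mono-≤ (⌊log₂⌋-mono-≤ 4≤n)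

total-cost-÷-≤ : ∀ B n X Y p q w M N K t₁ t₂ .{{_ : NonZero M}} .{{_ : NonZero N}} .{{_ : NonZero q}} →
  2 ≤ K → B * (M * N) ≤ n + n → w * q ≤ p →
  fromℕ (B * t₁ + B * M * t₂ + K * (X * (w * w) * Y)) ℚ.≤
    fromℕ K ℚ.* ((n ÷ (M * N)) {{m*n≢0 M N}} ℚ.* fromℕ t₁ ℚ.+ (n ÷ N) ℚ.* fromℕ t₂
      ℚ.+ fromℕ X ℚ.* ((p ÷ q) ℚ.* (p ÷ q)) ℚ.* fromℕ Y)
total-cost-÷-≤ B n X Y p q w M N K t₁ t₂ 2≤K BMN≤2n wq≤p = begin
  fromℕ (B * t₁ + B * M * t₂ + K * (X * (w * w) * Y))
    ≡⟨ trans (fromℕ-+ (B * t₁ + B * M * t₂) _) (cong (ℚ._+ fromℕ (K * (X * (w * w) * Y))) (fromℕ-+ (B * t₁) (B * M * t₂))) ⟩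
  fromℕ (B * t₁) ℚ.+ fromℕ (B * M * t₂) ℚ.+ fromℕ (K * (X * (w * w) * Y))
    ≤⟨ ℚ.+-mono-≤ (ℚ.+-mono-≤ blocks≤ subBlocks≤) matching≤ ⟩
  fromℕ K ℚ.* U ℚ.+ fromℕ K ℚ.* V ℚ.+ fromℕ K ℚ.* W
    ≡⟨ trans (cong (ℚ._+ fromℕ K ℚ.* W) (sym (ℚ.*-distribˡ-+ (fromℕ K) U V))) (sym (ℚ.*-distribˡ-+ (fromℕ K) (U ℚ.+ V) W)) ⟩
  fromℕ K ℚ.* (U ℚ.+ V ℚ.+ W) ∎
  where
  open ℚ.≤-Reasoning
  instance
    MN≢0 = m*n≢0 M N
    MN1≢0 = m*n≢0 (M * N) 1
    N1≢0 = m*n≢0 N 1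
    qq≢0 = m*n≢0 q q
    1qq≢0 = m*n≢0 1 (q * q)
    1qq1≢0 = m*n≢0 (1 * (q * q)) 1
  U = (n ÷ (M * N)) ℚ.* fromℕ t₁
  V = (n ÷ N) ℚ.* fromℕ t₂
  W = fromℕ X ℚ.* ((p ÷ q) ℚ.* (p ÷ q)) ℚ.* fromℕ Y

  ≤K* : ∀ t → B * (M * N) * t ≤ K * (n * t)
  ≤K* t = ≤-trans (*-monoˡ-≤ t BMN≤2n) (≤-trans (≤-reflexive (double n t)) (*-monoˡ-≤ (n * t) 2≤K))
    where
    double : ∀ n t → (n + n) * t ≡ 2 * (n * t)
    double = solve-∀

  blocks≤ : fromℕ (B * t₁) ℚ.≤ fromℕ K ℚ.* U
  blocks≤ = subst (λ z → fromℕ (B * t₁) ℚ.≤ fromℕ K ℚ.* z) (sym (÷-* n (M * N) t₁ 1))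
    (fromℕ-≤-*÷ (B * t₁) K (n * t₁) (M * N * 1) (≤-trans (≤-reflexive (rearrange B t₁ (M * N))) (≤K* t₁)))
    where
    rearrange : ∀ B t q → B * t * (q * 1) ≡ B * q * t
    rearrange = solve-∀

  subBlocks≤ : fromℕ (B * M * t₂) ℚ.≤ fromℕ K ℚ.* V
  subBlocks≤ = subst (λ z → fromℕ (B * M * t₂) ℚ.≤ fromℕ K ℚ.* z) (sym (÷-* n N t₂ 1))
    (fromℕ-≤-*÷ (B * M * t₂) K (n * t₂) (N * 1) (≤-trans (≤-reflexive (rearrange B M t₂ N)) (≤K* t₂)))
    where
    rearrange : ∀ B M t N → B * M * t * (N * 1) ≡ B * (M * N) * t
    rearrange = solve-∀

  W≡ : W ≡ (X * (p * p) * Y) ÷ (1 * (q * q) * 1)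
  W≡ = trans (cong (λ z → fromℕ X ℚ.* z ℚ.* fromℕ Y) (÷-* p q p q))
    (trans (cong (ℚ._* fromℕ Y) (÷-* X 1 (p * p) (q * q))) (÷-* (X * (p * p)) (1 * (q * q)) Y 1))

  matching≤ : fromℕ (K * (X * (w * w) * Y)) ℚ.≤ fromℕ K ℚ.* W
  matching≤ = subst (λ z → fromℕ (K * (X * (w * w) * Y)) ℚ.≤ fromℕ K ℚ.* z) (sym W≡)
    (fromℕ-≤-*÷ (K * (X * (w * w) * Y)) K (X * (p * p) * Y) (1 * (q * q) * 1)
      (≤-trans (≤-reflexive (rearrange K X w Y q))
        (*-monoʳ-≤ K (*-monoˡ-≤ Y (*-monoʳ-≤ X (*-mono-≤ wq≤p wq≤p))))))
    where
    rearrange : ∀ K X w Y q → K * (X * (w * w) * Y) * (1 * (q * q) * 1) ≡ K * (X * (w * q * (w * q)) * Y)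
    rearrange = solve-∀

theorem5p2 : (HS : HuntSzymanski) →
    ∃[ ε₀ ] 0ℚ ℚ.< ε₀ × ∃[ K ] ∃[ n₀ ]
    (∀ (ε : ℚ) .{{_ : Positive ε}} → ε ℚ.< ε₀ →
    ∀ {σ σ₁ σ₂ N₂ M₁ M₂ : ℕ}
    .{{_ : NonZero M₁}} .{{_ : NonZero M₂}} .{{_ : NonZero N₂}}
    (L₁ L₂ : ℕ) (T₁ T₂ : ℕ → ℕ)
    (C₁ : Code σ₁ (M₂ * N₂) M₁) (C₂ : Code σ₂ N₂ M₂) →
    ListDecodable ε C₁ L₁ → ListDecodable ε C₂ L₂ →
    (Dec₁ : Decoder ε C₁ T₁) (Dec₂ : Decoder ε C₂ T₂)
    (m : Vec (Fin σ) (M₁ * (M₂ * N₂)))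
    {ℓ′ : ℕ} (S′ : Vec (Symbol σ σ₁ σ₂) ℓ′) →
    let N₁ = M₂ * N₂
        S  = indexed C₁ C₂ m
        n  = (M₁ * N₁) ⊔ ℓ′
    in n₀ ℕ.≤ n →
    fromℕ (cost (enhancedEDApprox HS ε Dec₁ Dec₂ S S′))
    ℚ.≤ fromℕ K ℚ.*
    ((n ÷ N₁) {{m*n≢0 M₂ N₂}} ℚ.* fromℕ (T₁ N₁)
    ℚ.+ (n ÷ N₂) ℚ.* fromℕ (T₂ N₂)
    ℚ.+ fromℕ (N₂ * L₁ * L₂) ℚ.* (reciprocal ε ℚ.* reciprocal ε)
    ℚ.* fromℕ (n * loglog n)))
theorem5p2 HS = 1ℚ , ℚ.positive⁻¹ 1ℚ , constant κ c , n₀ ⊔ 4 ,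
  λ ε ε<1 {N₂ = N₂} {M₁ = M₁} {M₂ = M₂} L₁ L₂ T₁ T₂ C₁ C₂ listDecodable₁ listDecodable₂ Dec₁ Dec₂ m {ℓ′} S′ n₀⊔4≤n →
  let
    (p , q , 1/ε≡p/q , 0<w , wq≤p) = reciprocal-bounds ε ε<1
    w = ℤ.∣ ℚ.floor (reciprocal ε) ∣
    N₁ = M₂ * N₂
    ℓ = M₁ * N₁
    n = ℓ ⊔ ℓ′
    B = ceilDiv ℓ′ N₁ {{m*n≢0 M₂ N₂}}
    X = N₂ * L₁ * L₂
    K = constant κ c
    0<L₁ = listSize-positive C₁ ε<1 listDecodable₁
    0<L₂ = listSize-positive C₂ ε<1 listDecodable₂
    0<M₂ = ℕ.>-nonZero⁻¹ M₂
    0<N₂ = ℕ.>-nonZero⁻¹ N₂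
    4≤n = ≤-trans (m≤n⊔m n₀ 4) n₀⊔4≤n
    BN₁≤2n : B * N₁ ≤ n + n
    BN₁≤2n = ≤-trans (ceilDiv-*-≤ ℓ′ N₁ {{m*n≢0 M₂ N₂}})
      (+-mono-≤ (m≤n⊔m ℓ ℓ′) (≤-trans (m≤n*m N₁ M₁) (m≤m⊔n ℓ ℓ′)))
    cost≤ = ≤-trans
      (enhancedED-cost HS ε Dec₁ Dec₂ (indexed C₁ C₂ m) S′ 0<L₁ 0<L₂ 0<w listDecodable₁ listDecodable₂
        (≤-trans (m≤m⊔n n₀ 4) n₀⊔4≤n))
      (total-cost-≤ {n = n} {B} {X * (w * w)} {M₂} {N₂} {loglog n} κ c (T₁ N₁) (T₂ N₂)
        (m≤m⊔n ℓ ℓ′) (m≤n⊔m ℓ ℓ′) BN₁≤2n 0<M₂ 0<N₂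
        (((0<N₂ ⊛ 0<L₁) ⊛ 0<L₂) ⊛ 0<w ⊛ 0<w)
        (≤-trans (s≤s z≤n) 4≤n) (loglog-positive 4≤n))
  in ℚ.≤-trans (fromℕ-mono {cost (enhancedEDApprox HS ε Dec₁ Dec₂ (indexed C₁ C₂ m) S′)} {B * T₁ N₁ + B * M₂ * T₂ N₂ + K * (X * (w * w) * (n * loglog n))} cost≤)
    (subst (λ r → fromℕ (B * T₁ N₁ + B * M₂ * T₂ N₂ + K * (X * (w * w) * (n * loglog n))) ℚ.≤
        fromℕ K ℚ.* ((n ÷ N₁) {{m*n≢0 M₂ N₂}} ℚ.* fromℕ (T₁ N₁) ℚ.+ (n ÷ N₂) ℚ.* fromℕ (T₂ N₂)
          ℚ.+ fromℕ X ℚ.* (r ℚ.* r) ℚ.* fromℕ (n * loglog n)))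
      (sym 1/ε≡p/q)
      (total-cost-÷-≤ B n X (n * loglog n) p (suc q) w M₂ N₂ K (T₁ N₁) (T₂ N₂) (s≤s (s≤s z≤n)) BN₁≤2n wq≤p))
  where open HuntSzymanski HS using (c; n₀)
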